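{- Let $1\le k\le m$, let $l=(l_1,\dots,l_k)$ be integers with $0<l_1<\dots<l_k<m+1$, and let $\nu$ be a permutation of $[k]$. Let $f:[m]\to\mathbb{R}$ be such that the average $\frac{1}{m-l_i+1}\sum_{v=l_i}^{m}f(v)$ is the same for all $i\in[k]$, and define $g:S'_{k,m}\to\mathbb{R}$ by $g(x)=\sum_{i=1}^{k}f(x_i)$. Then $g$ is homomesic for $\underline{W}_\nu$ acting on $S'_{k,m}$.
   Context: $S_{k,m}$: integer $k$-tuples with $0<x_1<\dots<x_k<m+1$. Winching $W_i(x)=y$: $y_j=x_j$ ($j\ne i$), $y_i=x_i+1$ if $x_i+1<x_{i+1}$, else $y_i=x_{i-1}+1$, with $x_0=0$, $x_{k+1}=m+1$. Given lower bounds $l$, $S'_{k,m}=\{x\in S_{k,m}: x_i\ge l_i\ \forall i\}$; winching with lower bounds $\underline{W}_i$ agrees with $W_i$ except that its $i$-th coordinate is $\max\{(W_i(x))_i,\,l_i\}$ (it is a permutation of $S'_{k,m}$). $\underline{W}_\nu=\underline{W}_{\nu(k)}\circ\cdots\circ\underline{W}_{\nu(1)}$. A function on a finite set with a permutation $\tau$ is homomesic if its average over every $\tau$-orbit is the same constant. -}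

module Defs where

open import Data.Bool using (if_then_else_)
open import Data.Fin as Fin using (Fin; zero; suc; toℕ; inject₁; fromℕ)
open import Data.Fin.Permutation using (Permutation′; _⟨$⟩ʳ_)
import Data.Fin.Properties as Fin
open import Data.Integer using (+_; +≤+)
open import Data.Irrelevant using ([_])
open import Data.List using (foldl; allFin)
open import Data.Nat using (ℕ; zero; suc; _+_; _∸_; _⊔_; _≤_; _<_; z≤n; s≤s; s≤s⁻¹; _<?_; pred; NonZero)
open import Data.Nat.GeneralisedArithmetic using (fold)
import Data.Nat.Properties as ℕ
open import Data.Product using (Σ; ∃; _×_; _,_; proj₁; proj₂)
open import Data.Rational as ℚ using (ℚ; 0ℚ; 1ℚ; ½)
import Data.Rational.Properties as ℚ
import Data.Rational.Unnormalised as ℚᵘ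
import Data.Rational.Unnormalised.Properties as ℚᵘ
open import Data.Rational.Solver using (module +-*-Solver)
open import Data.Refinement using (Refinement-syntax; value; value-injective; _,_)
open import Data.Vec using (Vec; []; _∷_; _∷ʳ_; lookup; _[_]≔_; _[_]%=_)
import Data.Vec.Functional as Vector
import Data.Vec.Properties as Vec
open import Function using (_∘_; _↔_; mk↔ₛ′; Inverse; _⇔_; Injective)
open import Function.Construct.Composition using (_↔-∘_)
open import Function.Construct.Identity using (↔-id)
open import Relation.Binary.PropositionalEquality using (_≡_; _≢_; refl; sym; trans; cong; subst; subst₂)
open import Relation.Nullary using (¬_; Dec; yes; no; contradiction)
open import Relation.Nullary.Decidable using (⌊_⌋; recompute)

------------------------------------------------------------------------
-- Real numbers: Cauchy sequences of rationals, with _≈_ (the difference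
-- tends to 0) as equality.  Only the additive structure and division by
-- positive integers are needed to speak of averages.

record ℝ : Set where
  constructor mkℝ
  field
    seq    : ℕ → ℚ
    cauchy : ∀ ε → 0ℚ ℚ.< ε → ∃ λ N → ∀ i j → N ≤ i → N ≤ j →
             ℚ.∣ seq i ℚ.- seq j ∣ ℚ.< ε
open ℝ public

infix 4 _≈_
_≈_ : ℝ → ℝ → Set
x ≈ y = ∀ ε → 0ℚ ℚ.< ε → ∃ λ N → ∀ i → N ≤ i → ℚ.∣ seq x i ℚ.- seq y i ∣ ℚ.< ε

0ℝ : ℝ
0ℝ = mkℝ (λ _ → 0ℚ) (λ ε ε>0 → 0 , λ _ _ _ _ → ε>0)

0<½ε : ∀ {ε} → 0ℚ ℚ.< ε → 0ℚ ℚ.< ½ ℚ.* ε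
0<½ε {ε} ε>0 = subst (ℚ._< ½ ℚ.* ε) (ℚ.*-zeroʳ ½) (ℚ.*-monoʳ-<-pos ½ ε>0)

½ε+½ε≡ε : ∀ ε → ½ ℚ.* ε ℚ.+ ½ ℚ.* ε ≡ ε
½ε+½ε≡ε ε = trans (sym (ℚ.*-distribʳ-+ ε ½ ½)) (ℚ.*-identityˡ ε)

infixl 6 _+ℝ_
_+ℝ_ : ℝ → ℝ → ℝ
x +ℝ y = mkℝ (λ i → seq x i ℚ.+ seq y i) λ ε ε>0 →
  let M , x-close = cauchy x (½ ℚ.* ε) (0<½ε ε>0)
      N , y-close = cauchy y (½ ℚ.* ε) (0<½ε ε>0)
  in M ⊔ N , λ i j i≥ j≥ →
    let open ℚ.≤-Reasoning
        a = seq x i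
        b = seq y i
        c = seq x j
        d = seq y j
    in begin-strict
      ℚ.∣ (a ℚ.+ b) ℚ.- (c ℚ.+ d) ∣           ≡⟨ cong ℚ.∣_∣ (interchange a b c d) ⟩
      ℚ.∣ (a ℚ.- c) ℚ.+ (b ℚ.- d) ∣           ≤⟨ ℚ.∣p+q∣≤∣p∣+∣q∣ (a ℚ.- c) (b ℚ.- d) ⟩
      ℚ.∣ a ℚ.- c ∣ ℚ.+ ℚ.∣ b ℚ.- d ∣         <⟨ ℚ.+-mono-< (x-close i j (ℕ.m⊔n≤o⇒m≤o M N i≥) (ℕ.m⊔n≤o⇒m≤o M N j≥))
                                                            (y-close i j (ℕ.m⊔n≤o⇒n≤o M N i≥) (ℕ.m⊔n≤o⇒n≤o M N j≥)) ⟩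
      ½ ℚ.* ε ℚ.+ ½ ℚ.* ε                     ≡⟨ ½ε+½ε≡ε ε ⟩
      ε                                       ∎
  where
  interchange : ∀ a b c d → (a ℚ.+ b) ℚ.- (c ℚ.+ d) ≡ (a ℚ.- c) ℚ.+ (b ℚ.- d)
  interchange = solve 4 (λ a b c d → (a :+ b) :- (c :+ d) := (a :- c) :+ (b :- d)) refl
    where open +-*-Solver

0≤1/n : ∀ n .{{_ : NonZero n}} → 0ℚ ℚ.≤ + 1 ℚ./ n
0≤1/n n = ℚ.nonNegative⁻¹ (+ 1 ℚ./ n) {{ℚ.normalize-nonNeg 1 n}}

1/n≤1 : ∀ n .{{_ : NonZero n}} → + 1 ℚ./ n ℚ.≤ 1ℚ
1/n≤1 (suc n) = ℚ.toℚᵘ-cancel-≤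
  (ℚᵘ.≤-respˡ-≃ (ℚᵘ.≃-sym (ℚ.toℚᵘ-fromℚᵘ (ℚᵘ.mkℚᵘ (+ 1) n)))
    (ℚᵘ.*≤* (+≤+ (s≤s z≤n))))

infixl 7 _/ℝ_
_/ℝ_ : ℝ → (n : ℕ) → .{{NonZero n}} → ℝ
x /ℝ n = mkℝ (λ i → + 1 ℚ./ n ℚ.* seq x i) λ ε ε>0 →
  let N , x-close = cauchy x ε ε>0
  in N , λ i j i≥ j≥ →
    let open ℚ.≤-Reasoning
        q = + 1 ℚ./ n
        d = seq x i ℚ.- seq x j
        instance
          ∣d∣-nonNeg : ℚ.NonNegative ℚ.∣ d ∣
          ∣d∣-nonNeg = ℚ.nonNegative (ℚ.0≤∣p∣ d)
    in begin-strict
      ℚ.∣ q ℚ.* seq x i ℚ.- q ℚ.* seq x j ∣   ≡⟨ cong ℚ.∣_∣ (factor q (seq x i) (seq x j)) ⟩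
      ℚ.∣ q ℚ.* d ∣                           ≡⟨ ℚ.∣p*q∣≡∣p∣*∣q∣ q d ⟩
      ℚ.∣ q ∣ ℚ.* ℚ.∣ d ∣                     ≡⟨ cong (ℚ._* ℚ.∣ d ∣) (ℚ.0≤p⇒∣p∣≡p (0≤1/n n)) ⟩
      q ℚ.* ℚ.∣ d ∣                           ≤⟨ ℚ.*-monoʳ-≤-nonNeg ℚ.∣ d ∣ (1/n≤1 n) ⟩
      1ℚ ℚ.* ℚ.∣ d ∣                          ≡⟨ ℚ.*-identityˡ ℚ.∣ d ∣ ⟩
      ℚ.∣ d ∣                                 <⟨ x-close i j i≥ j≥ ⟩
      ε                                       ∎
  where
  factor : ∀ q a b → q ℚ.* a ℚ.- q ℚ.* b ≡ q ℚ.* (a ℚ.- b)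
  factor = solve 3 (λ q a b → q :* a :- q :* b := q :* (a :- b)) refl
    where open +-*-Solver

sumℝ : ∀ {n} → (Fin n → ℝ) → ℝ
sumℝ = Vector.foldr _+ℝ_ 0ℝ

average : ∀ {n} → .{{NonZero n}} → (Fin n → ℝ) → ℝ
average {n} a = sumℝ a /ℝ n

------------------------------------------------------------------------
-- Homomesy

-- A repetition-free enumeration of the orbit of x.  Forward iterates
-- suffice: if they form a finite set, they exhaust the orbit of the
-- permutation τ.
record Orbit {X : Set} (τ : X ↔ X) (x : X) : Set where
  field
    size             : ℕ
    {{size-nonZero}} : NonZero size
    element          : Fin size → X
    injective        : Injective _≡_ _≡_ element
    exhaustive       : ∀ y → (∃ λ j → element j ≡ y) ⇔ (∃ λ n → fold x (Inverse.to τ) n ≡ y)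
open Orbit public

-- The enumeration of the orbit is unique up to reordering, so the
-- average does not depend on which one is supplied; asking for one
-- (rather than assuming one) keeps the statement non-vacuous.
Homomesic : {X : Set} → (X ↔ X) → (X → ℝ) → Set
Homomesic {X} τ g =
  ∃ λ (c : ℝ) → (x : X) → Σ (Orbit τ x) λ O → average (g ∘ element O) ≈ c

------------------------------------------------------------------------
-- The sets [m], S_{k,m} and S'_{k,m}

⟦_⟧ : ℕ → Set
⟦ m ⟧ = [ v ∈ ℕ ∣ 0 < v × v < suc m ]

-- (x₀ , x₁ , … , x_k , x_{k+1}) with x₀ = 0 and x_{k+1} = m + 1.
extend : ∀ {k} → ℕ → Vec ℕ k → Vec ℕ (suc (suc k))
extend m x = 0 ∷ (x ∷ʳ suc m)

Chain : ∀ {n} → Vec ℕ (suc n) → Set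
Chain {n} y = (i : Fin n) → lookup y (inject₁ i) < lookup y (suc i)

S : ℕ → ℕ → Set
S k m = [ x ∈ Vec ℕ k ∣ Chain (extend m x) ]

S′ : ∀ {k m} → S k m → Set
S′ {k} {m} l = [ x ∈ S k m ∣ (∀ i → lookup (value l) i ≤ lookup (value x) i) ]

-- For i : Fin k standing for the (1-based) index i, these are x_{i-1}
-- and x_{i+1} in the extended tuple.
before after : ∀ {k} → ℕ → Vec ℕ k → Fin k → ℕ
before m x i = lookup (extend m x) (inject₁ (inject₁ i))
after  m x i = lookup (extend m x) (suc (suc i))

lookup-∷ʳ : ∀ {k} (x : Vec ℕ k) a i → lookup (x ∷ʳ a) (inject₁ i) ≡ lookup x i
lookup-∷ʳ (_ ∷ _) a zero    = refl
lookup-∷ʳ (_ ∷ x) a (suc i) = lookup-∷ʳ x a i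

lookup-∷ʳ-last : ∀ {k} (x : Vec ℕ k) a → lookup (x ∷ʳ a) (fromℕ k) ≡ a
lookup-∷ʳ-last []      a = refl
lookup-∷ʳ-last (_ ∷ x) a = lookup-∷ʳ-last x a

chain-first : ∀ {n} (y : Vec ℕ (suc n)) → Chain y → ∀ i → lookup y zero < lookup y (suc i)
chain-first (_ ∷ _ ∷ _) c zero    = c zero
chain-first (_ ∷ y@(_ ∷ _)) c (suc i) = ℕ.<-trans (c zero) (chain-first y (c ∘ suc) i)

chain-last : ∀ {n} (y : Vec ℕ (suc n)) → Chain y → ∀ i → lookup y (inject₁ i) < lookup y (fromℕ n)
chain-last {suc n} y c zero = chain-first y c (fromℕ n)
chain-last {suc n} (_ ∷ y) c (suc i) = chain-last y (c ∘ suc) i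

module _ {k} (m : ℕ) (x : Vec ℕ k) (c : Chain (extend m x)) (i : Fin k) where

  before< : before m x i < lookup x i
  before< = subst (before m x i <_) (lookup-∷ʳ x (suc m) i) (c (inject₁ i))

  <after : lookup x i < after m x i
  <after = subst (_< after m x i) (lookup-∷ʳ x (suc m) i) (c (suc i))

  0<coordinate : 0 < lookup x i
  0<coordinate = subst (0 <_) (lookup-∷ʳ x (suc m) i) (chain-first (extend m x) c (inject₁ i))

  coordinate<1+m : lookup x i < suc m
  coordinate<1+m = subst₂ _<_ (lookup-∷ʳ x (suc m) i) (lookup-∷ʳ-last x (suc m))
                     (chain-last (extend m x) c (suc i))

coordinate : ∀ {k m} → S k m → Fin k → ⟦ m ⟧
coordinate {m = m} (x , [ c ]) i = lookup x i , [ 0<coordinate m x c i , coordinate<1+m m x c i ]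

------------------------------------------------------------------------
-- Replacing one coordinate

extend-update : ∀ {k} m (x : Vec ℕ k) i a →
                extend m (x [ i ]≔ a) ≡ extend m x [ suc (inject₁ i) ]≔ a
extend-update m x i a = cong (0 ∷_) (go x i)
  where
  go : ∀ {k} (x : Vec ℕ k) i → (x [ i ]≔ a) ∷ʳ suc m ≡ (x ∷ʳ suc m) [ inject₁ i ]≔ a
  go (_ ∷ _) zero    = refl
  go (b ∷ x) (suc i) = cong (b ∷_) (go x i)

before-index≢ : ∀ {k} (i : Fin k) → inject₁ (inject₁ i) ≢ suc (inject₁ i)
before-index≢ i eq = ℕ.<⇒≢ (ℕ.n<1+n (toℕ i))
  (trans (sym (trans (Fin.toℕ-inject₁ (inject₁ i)) (Fin.toℕ-inject₁ i)))
    (trans (cong toℕ eq) (cong suc (Fin.toℕ-inject₁ i))))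

after-index≢ : ∀ {k} (i : Fin k) → suc (suc i) ≢ suc (inject₁ i)
after-index≢ i eq = ℕ.<⇒≢ (ℕ.n<1+n (toℕ i))
  (sym (trans (ℕ.suc-injective (cong toℕ eq)) (Fin.toℕ-inject₁ i)))

before-update : ∀ {k} m (x : Vec ℕ k) i a → before m (x [ i ]≔ a) i ≡ before m x i
before-update m x i a = trans (cong (λ y → lookup y (inject₁ (inject₁ i))) (extend-update m x i a))
  (Vec.lookup∘updateAt′ _ _ (before-index≢ i) (extend m x))

after-update : ∀ {k} m (x : Vec ℕ k) i a → after m (x [ i ]≔ a) i ≡ after m x i
after-update m x i a = trans (cong (λ y → lookup y (suc (suc i))) (extend-update m x i a))
  (Vec.lookup∘updateAt′ _ _ (after-index≢ i) (extend m x))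

update-chain : ∀ {k} m (x : Vec ℕ k) → Chain (extend m x) → ∀ i a →
               before m x i < a → a < after m x i → Chain (extend m (x [ i ]≔ a))
update-chain m x c i a b<a a<t j = subst (λ y → lookup y (inject₁ j) < lookup y (suc j))
  (sym (extend-update m x i a)) (go (inject₁ i Fin.≟ j) (suc i Fin.≟ j))
  where
  y = extend m x
  p = suc (inject₁ i)
  at-p : lookup (y [ p ]≔ a) p ≡ a
  at-p = Vec.lookup∘updateAt p y
  off-p : ∀ q → q ≢ p → lookup (y [ p ]≔ a) q ≡ lookup y q
  off-p q q≢p = Vec.lookup∘updateAt′ q p q≢p y
  go : Dec (inject₁ i ≡ j) → Dec (suc i ≡ j) →
       lookup (y [ p ]≔ a) (inject₁ j) < lookup (y [ p ]≔ a) (suc j)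
  go (yes refl) _ = subst₂ _<_ (sym (off-p _ (before-index≢ i))) (sym at-p) b<a
  go (no _) (yes refl) = subst₂ _<_ (sym at-p) (sym (off-p _ (after-index≢ i))) a<t
  go (no i≢j) (no i+1≢j) = subst₂ _<_
    (sym (off-p _ (λ eq → i+1≢j (sym (Fin.inject₁-injective eq)))))
    (sym (off-p _ (λ eq → i≢j (sym (Fin.suc-injective eq)))))
    (c j)

------------------------------------------------------------------------
-- Winching

-- The new value of x_i, from p = x_{i-1}, x_i = a and t = x_{i+1}.
step : (p a t : ℕ) → ℕ
step p a t = if ⌊ suc a <? t ⌋ then suc a else suc p

step> : ∀ {p a t} → p < a → p < step p a t
step> {p} {a} {t} p<a with suc a <? t
... | yes _ = ℕ.m<n⇒m<1+n p<a
... | no  _ = ℕ.n<1+n p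

step< : ∀ {p a t} → p < a → a < t → step p a t < t
step< {p} {a} {t} p<a a<t with suc a <? t
... | yes 1+a<t = 1+a<t
... | no  _     = ℕ.≤-<-trans p<a a<t

W : ∀ {k m} → Fin k → S k m → S k m
W {m = m} i (x , [ c ]) = (x [ i ]≔ a′)
                        , [ update-chain m x c i a′ (step> (before< m x c i)) (step< (before< m x c i) (<after m x c i)) ]
  where a′ = step (before m x i) (lookup x i) (after m x i)

-- Inverse of  λ a → step p a t ⊔ b  on  { a ∣ p < a < t , b ≤ a }.
unstep : (p a t b : ℕ) → ℕ
unstep p a t b = if ⌊ suc p ⊔ b <? a ⌋ then pred a else pred t

module _ {p a t b : ℕ} (p<a : p < a) (a<t : a < t) (b≤a : b ≤ a) where

  private
    low≤a : suc p ⊔ b ≤ a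
    low≤a = ℕ.⊔-lub p<a b≤a

    suc-pred : ∀ {n a} → n < a → suc (pred a) ≡ a
    suc-pred {a = suc _} _ = refl

  unstep> : p < unstep p a t b
  unstep> with suc p ⊔ b <? a
  ... | yes q = ℕ.≤-trans (ℕ.m≤m⊔n (suc p) b) (ℕ.<⇒≤pred q)
  ... | no  _ = ℕ.<-≤-trans p<a (ℕ.<⇒≤pred a<t)

  unstep< : unstep p a t b < t
  unstep< with suc p ⊔ b <? a
  ... | yes _ = ℕ.≤-<-trans ℕ.pred[n]≤n a<t
  ... | no  _ = pred< a<t
    where
    pred< : ∀ {t} → a < t → pred t < t
    pred< {suc t} _ = ℕ.n<1+n t

  unstep≥ : b ≤ unstep p a t b
  unstep≥ with suc p ⊔ b <? a
  ... | yes q = ℕ.≤-trans (ℕ.m≤n⊔m (suc p) b) (ℕ.<⇒≤pred q)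
  ... | no  _ = ℕ.≤-trans b≤a (ℕ.<⇒≤pred a<t)

  unstep-step : unstep p (step p a t ⊔ b) t b ≡ a
  unstep-step with suc a <? t
  ... | yes _ rewrite ℕ.m≥n⇒m⊔n≡m (ℕ.m≤n⇒m≤1+n b≤a) with suc p ⊔ b <? suc a
  ...   | yes _ = refl
  ...   | no ≮  = contradiction (s≤s low≤a) ≮
  unstep-step | no 1+a≮t with suc p ⊔ b <? suc p ⊔ b
  ...   | yes q = contradiction q (ℕ.<-irrefl refl)
  ...   | no _  = cong pred (ℕ.≤-antisym (ℕ.≮⇒≥ 1+a≮t) a<t)

  step-unstep : step p (unstep p a t b) t ⊔ b ≡ a
  step-unstep with suc p ⊔ b <? a
  step-unstep | yes low<a with suc (pred a) <? t
  ... | yes _ = trans (cong (_⊔ b) (suc-pred low<a)) (ℕ.m≥n⇒m⊔n≡m b≤a)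
  ... | no ≮ = contradiction (subst (_< t) (sym (suc-pred low<a)) a<t) ≮
  step-unstep | no low≮a with suc (pred t) <? t
  ... | yes q = contradiction q (1+pred≮ a<t)
    where
    1+pred≮ : ∀ {t} → a < t → ¬ (suc (pred t) < t)
    1+pred≮ {suc _} _ = ℕ.<-irrefl refl
  ... | no _  = ℕ.≤-antisym low≤a (ℕ.≮⇒≥ low≮a)

module _ {k m} (l : S k m) (i : Fin k) where

  private
    b = lookup (value l) i

    raise-update : ∀ (x : Vec ℕ k) a → (x [ i ]≔ a) [ i ]%= (_⊔ b) ≡ x [ i ]≔ (a ⊔ b)
    raise-update x a = Vec.updateAt-updateAt i x

    Bounded : Vec ℕ k → Set
    Bounded x = ∀ j → lookup (value l) j ≤ lookup x j

    update-bounded : ∀ (x : Vec ℕ k) a → Bounded x → b ≤ a → Bounded (x [ i ]≔ a)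
    update-bounded x a bd b≤a j with j Fin.≟ i
    ... | yes refl = subst (b ≤_) (sym (Vec.lookup∘updateAt i x)) b≤a
    ... | no j≢i   = subst (lookup (value l) j ≤_) (sym (Vec.lookup∘updateAt′ j i j≢i x)) (bd j)

    stepped unstepped : Vec ℕ k → ℕ
    stepped x   = step (before m x i) (lookup x i) (after m x i)
    unstepped x = unstep (before m x i) (lookup x i) (after m x i) b

    raise-chain : ∀ x → Chain (extend m x) → Bounded x →
                  Chain (extend m ((x [ i ]≔ stepped x) [ i ]%= (_⊔ b)))
    raise-chain x c bd = subst (λ y → Chain (extend m y)) (sym (raise-update x (stepped x)))
      (update-chain m x c i (stepped x ⊔ b)
        (ℕ.<-≤-trans (step> (before< m x c i)) (ℕ.m≤m⊔n (stepped x) b))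
        (ℕ.⊔-pres-<m (step< (before< m x c i) (<after m x c i))
                   (ℕ.≤-<-trans (bd i) (<after m x c i))))

    raise-bounded : ∀ x → Bounded x → Bounded ((x [ i ]≔ stepped x) [ i ]%= (_⊔ b))
    raise-bounded x bd = subst Bounded (sym (raise-update x (stepped x)))
      (update-bounded x (stepped x ⊔ b) bd (ℕ.m≤n⊔m (stepped x) b))

  lowerWinch : S′ l → S′ l
  lowerWinch (x , [ bd ]) = lowered x bd
    where
    lowered : (x : S k m) → .(Bounded (value x)) → S′ l
    lowered x@(v , [ c ]) bd = ((value (W i x) [ i ]%= (_⊔ b)) , [ raise-chain v c bd ])
                             , [ raise-bounded v bd ]

  lowerUnwinch : S′ l → S′ l
  lowerUnwinch ((x , [ c ]) , [ bd ]) =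
    ( (x [ i ]≔ unstepped x)
    , [ update-chain m x c i (unstepped x)
          (unstep> (before< m x c i) (<after m x c i) (bd i))
          (unstep< (before< m x c i) (<after m x c i) (bd i)) ] )
    , [ update-bounded x (unstepped x) bd (unstep≥ (before< m x c i) (<after m x c i) (bd i)) ]

  private
    S′-≡ : {x y : S′ l} → value (value x) ≡ value (value y) → x ≡ y
    S′-≡ eq = value-injective (value-injective eq)

    restore : ∀ (x : Vec ℕ k) {a} → a ≡ lookup x i → x [ i ]≔ a ≡ x
    restore x refl = Vec.[]≔-lookup x i

    cong₃ : ∀ {A : Set} (f : ℕ → ℕ → ℕ → A) {p p′ a a′ t t′} →
            p ≡ p′ → a ≡ a′ → t ≡ t′ → f p a t ≡ f p′ a′ t′
    cong₃ f refl refl refl = refl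

    unwinch-winch : ∀ x → Chain (extend m x) → Bounded x →
                    let y = (x [ i ]≔ stepped x) [ i ]%= (_⊔ b) in y [ i ]≔ unstepped y ≡ x
    unwinch-winch x c bd rewrite raise-update x (stepped x) =
      trans (Vec.[]≔-idempotent x i) (restore x (trans
        (cong₃ (λ p a t → unstep p a t b) (before-update m x i _) (Vec.lookup∘updateAt i x) (after-update m x i _))
        (unstep-step (before< m x c i) (<after m x c i) (bd i))))

    winch-unwinch : ∀ x → Chain (extend m x) → Bounded x →
                    let y = x [ i ]≔ unstepped x in (y [ i ]≔ stepped y) [ i ]%= (_⊔ b) ≡ x
    winch-unwinch x c bd = trans (raise-update _ _) (trans (Vec.[]≔-idempotent x i) (restore x (trans
        (cong₃ (λ p a t → step p a t ⊔ b) (before-update m x i _) (Vec.lookup∘updateAt i x) (after-update m x i _))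
        (step-unstep (before< m x c i) (<after m x c i) (bd i)))))

  W̲ : S′ l ↔ S′ l
  W̲ = mk↔ₛ′ lowerWinch lowerUnwinch
    (λ { ((x , [ c ]) , [ bd ]) → S′-≡ (recompute (Vec.≡-dec ℕ._≟_ _ _) (winch-unwinch x c bd)) })
    (λ { ((x , [ c ]) , [ bd ]) → S′-≡ (recompute (Vec.≡-dec ℕ._≟_ _ _) (unwinch-winch x c bd)) })

-- The left fold applies the factor indexed by ν(1) first.
W̲-along : ∀ {k m} (l : S k m) → Permutation′ k → S′ l ↔ S′ l
W̲-along {k} l ν = foldl (λ τ i → W̲ l (ν ⟨$⟩ʳ i) ↔-∘ τ) (↔-id _) (allFin k)

------------------------------------------------------------------------
-- The statistic and the averages of f

shift< : ∀ {m v} → v < suc m → (j : Fin (suc (m ∸ v))) → v + toℕ j < suc m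
shift< {m} {v} v<1+m j = s≤s (subst (v + toℕ j ≤_) (ℕ.m+[n∸m]≡n (s≤s⁻¹ v<1+m))
  (ℕ.+-monoʳ-≤ v (s≤s⁻¹ (Fin.toℕ<n j))))

-- (1 / (m - v + 1)) · Σ_{w = v}^{m} f(w), with w = v + j.
upperAverage : ∀ {m} → (⟦ m ⟧ → ℝ) → ⟦ m ⟧ → ℝ
upperAverage {m} f (v , [ bounds ]) = average {suc (m ∸ v)} λ j →
  f (v + toℕ j , [ ℕ.<-≤-trans (proj₁ bounds) (ℕ.m≤m+n v (toℕ j)) , shift< (proj₂ bounds) j ])

sumStatistic : ∀ {k m} (l : S k m) → (⟦ m ⟧ → ℝ) → S′ l → ℝ
sumStatistic l f x = sumℝ λ i → f (coordinate (value x) i)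

{-# OPTIONS --safe #-}

-- Let c be the common average, φ = f − c and F(v) = Σ_{w=v}^{m} φ(w), so that F
-- vanishes at every l_i and at m + 1.  For u < v write E(u,v) = F(v) if v = u + 1
-- and E(u,v) = 0 otherwise.  Winching a coordinate with value a, whose neighbours
-- are p and t at that moment, into the value b satisfies
--     F(a + 1) + E(p,b) = F(b) + E(a,t).
-- Over one round the left and the right contacts E of adjacent coordinates cancel, up
-- to the contacts of those pairs whose left member is winched first, which are
-- read off the tuples before and after the round.  Hence Σ_i φ(x_i) = Ψ(x) − Ψ(W̲_ν x)
-- for an explicit potential Ψ, and the sum of Σ_i φ(x_i) over an orbit vanishes.
module Submission where

open import Defs
open import Algebra.Bundles using (AbelianGroup)
import Algebra.Properties.AbelianGroup as AbelianGroupProperties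
import Algebra.Properties.CommutativeMonoid.Sum as Sum
import Algebra.Properties.CommutativeSemigroup as CommutativeSemigroupProperties
import Algebra.Solver.CommutativeMonoid as CommutativeMonoidSolver
open import Data.Bool using (Bool; true; false; if_then_else_)
open import Data.Fin using (Fin; zero; suc; toℕ; inject₁; fromℕ; fromℕ<; funToFin; finToFun)
open import Data.Fin.Permutation as Permutation using (Permutation′; _⟨$⟩ʳ_; _⟨$⟩ˡ_)
import Data.Fin.Properties as Fin
open import Data.Fin.Relation.Unary.Top using (view; ‵fromℕ; ‵inject₁)
open import Data.Integer as ℤ using (+_)
import Data.Integer.Properties as ℤ
open import Data.Irrelevant using ([_])
open import Data.List using ([]; _∷_; foldl; tabulate; allFin)
open import Data.Nat using (ℕ; zero; suc; _+_; _*_; _∸_; _⊔_; _^_; _%_; _/_; _≤_; _<_; z≤n; s≤s; s≤s⁻¹; _<?_; _≤?_; _≟_; _≤′_; ≤′-refl; ≤′-step; NonZero)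
open import Data.Nat.DivMod using (m%n<n; m≡m%n+[m/n]*n)
open import Data.Nat.GeneralisedArithmetic using (fold; fold-+)
import Data.Nat.Properties as ℕ
open import Data.Product using (Σ; ∃; _×_; _,_; proj₁; proj₂)
open import Data.Rational as ℚ using (ℚ; 0ℚ; 1ℚ; ½)
import Data.Rational.Properties as ℚ
open import Data.Rational.Solver using (module +-*-Solver)
import Data.Rational.Unnormalised as ℚᵘ
import Data.Rational.Unnormalised.Properties as ℚᵘ
open import Data.Refinement using (value; value-injective; _,_)
open import Data.Vec as Vec using (Vec; lookup; _∷ʳ_)
import Data.Vec.Properties as Vec
import Data.Vec.Relation.Binary.Pointwise.Extensional as Pointwise
open import Function using (_∘_; _$_; _↔_; Inverse; Injective; mk⇔)
open import Function.Construct.Composition using (_↔-∘_)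
open import Function.Construct.Identity using (↔-id)
open import Level using (Level; 0ℓ)
open import Relation.Binary using (tri<; tri≈; tri>)
open import Relation.Binary.PropositionalEquality as ≡ using (_≡_; _≢_; cong; subst; subst₂; module ≡-Reasoning)
import Relation.Binary.Reasoning.Setoid as SetoidReasoning
open import Relation.Nullary using (¬_; yes; no; contradiction)
open import Relation.Nullary.Decidable using (⌊_⌋; _×-dec_; map′; recompute)
open import Relation.Nullary.Negation using (contradiction-irr)
open import Relation.Unary using (Decidable)

-- Trajectories of a fold, and quantities that change at a single time.

foldl-trajectory : ∀ {A B : Set} (s : B → A → B) n (f : Fin n → A) (b : B) → ∃ λ (z : ℕ → B) →
                   z 0 ≡ b × z n ≡ foldl s b (tabulate f) × (∀ i → z (suc (toℕ i)) ≡ s (z (toℕ i)) (f i))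
foldl-trajectory s zero    f b = (λ _ → b) , ≡.refl , ≡.refl , λ ()
foldl-trajectory {B = B} s (suc n) f b with foldl-trajectory s n (f ∘ suc) (s b (f zero))
... | z , start , end , next = z′ , ≡.refl , end , next′
  where
  z′ : ℕ → B
  z′ zero    = b
  z′ (suc j) = z j
  next′ : ∀ i → z′ (suc (toℕ i)) ≡ s (z′ (toℕ i)) (f i)
  next′ zero    = start
  next′ (suc i) = next i

-- Models the history of one coordinate over a round of `n` moves, `p` being the time of its own
-- move. If `p` is at least `n`, the history is constant throughout.
StaticExcept : {A : Set} → ℕ → ℕ → (ℕ → A) → Set
StaticExcept n p h = ∀ j → j < n → j ≢ p → h (suc j) ≡ h j

static-until : ∀ {A : Set} {n p} {h : ℕ → A} → StaticExcept n p h → ∀ j → j ≤ n → j ≤ p → h j ≡ h 0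
static-until static zero    _   _   = ≡.refl
static-until static (suc j) j<n j<p = ≡.trans (static j j<n (ℕ.<⇒≢ j<p))
  (static-until static j (ℕ.<⇒≤ j<n) (ℕ.<⇒≤ j<p))

static-since : ∀ {A : Set} {n p} {h : ℕ → A} → StaticExcept n p h → ∀ j → j ≤ n → p < j → h j ≡ h n
static-since {p = p} {h} static j j≤n p<j = go static (ℕ.≤⇒≤′ j≤n)
  where
  go : ∀ {n} → StaticExcept n p h → j ≤′ n → h j ≡ h n
  go static ≤′-refl = ≡.refl
  go static (≤′-step {n} j≤n) = ≡.trans
    (go (λ i i<n → static i (ℕ.m<n⇒m<1+n i<n)) j≤n)
    (≡.sym (static n ℕ.≤-refl (ℕ.>⇒≢ (ℕ.<-≤-trans p<j (ℕ.≤′⇒≤ j≤n)))))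

-- The times at which the coordinates are winched.

module _ {k : ℕ} (ν : Permutation′ k) where

  private
    turns : Vec ℕ k
    turns = Vec.tabulate (λ i → toℕ (ν ⟨$⟩ˡ i))

    lookup-turns : ∀ i → lookup (turns ∷ʳ suc k) (inject₁ i) ≡ toℕ (ν ⟨$⟩ˡ i)
    lookup-turns i = ≡.trans (lookup-∷ʳ turns (suc k) i) (Vec.lookup∘tabulate _ i)

  -- The values at the sentinels x₀ and x_{k+1} are arbitrary, except that the last
  -- one has to differ from its neighbour.
  turn : Fin (suc (suc k)) → ℕ
  turn = lookup (extend k turns)

  turn-inner : ∀ i → turn (suc (inject₁ i)) ≡ toℕ (ν ⟨$⟩ˡ i)
  turn-inner = lookup-turns

  turn-adjacent-≢ : ∀ i → turn (suc (suc i)) ≢ turn (suc (inject₁ i))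
  turn-adjacent-≢ i eq = go (suc i) (after-index≢ i ∘ cong suc) eq
    where
    go : ∀ q → q ≢ inject₁ i → turn (suc q) ≢ turn (suc (inject₁ i))
    go q q≢i eq with view q
    ... | ‵fromℕ = ℕ.>⇒≢ (ℕ.m<n⇒m<1+n (Fin.toℕ<n (ν ⟨$⟩ˡ i)))
      (≡.trans (≡.sym (lookup-∷ʳ-last turns (suc k))) (≡.trans eq (lookup-turns i)))
    ... | ‵inject₁ j = q≢i (cong inject₁ (begin
      j                        ≡⟨ Permutation.inverseʳ ν ⟨
      ν ⟨$⟩ʳ (ν ⟨$⟩ˡ j)        ≡⟨ cong (ν ⟨$⟩ʳ_) (Fin.toℕ-injective (begin
        toℕ (ν ⟨$⟩ˡ j)           ≡⟨ lookup-turns j ⟨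
        turn (suc (inject₁ j))   ≡⟨ eq ⟩
        turn (suc (inject₁ i))   ≡⟨ lookup-turns i ⟩
        toℕ (ν ⟨$⟩ˡ i)           ∎)) ⟩
      ν ⟨$⟩ʳ (ν ⟨$⟩ˡ i)        ≡⟨ Permutation.inverseʳ ν ⟩
      i                        ∎))
      where open ≡-Reasoning

  -- An edge `e` joins the positions `inject₁ e` and `suc e` of the extended tuple, so coordinate
  -- `i` has `inject₁ i` as its left edge and `suc i` as its right edge.
  leftFirst : Fin (suc k) → Bool
  leftFirst e = ⌊ turn (inject₁ e) <? turn (suc e) ⌋

-- Coordinates of a tuple and their evolution during one round.

module _ {k m : ℕ} (l : S k m) where

  coord : S′ l → Fin k → ℕ
  coord x = lookup (value (value x))

  ext : S′ l → Fin (suc (suc k)) → ℕ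
  ext x = lookup (extend m (value (value x)))

  ext≡coord : ∀ x i → ext x (suc (inject₁ i)) ≡ coord x i
  ext≡coord x i = lookup-∷ʳ (value (value x)) (suc m) i

  -- The stored chain proof is irrelevant; decidability of `_<_` recovers a relevant one.
  ext-chain : ∀ x → Chain (extend m (value (value x)))
  ext-chain x@((_ , [ c ]) , _) i = recompute (ext x (inject₁ i) <? ext x (suc i)) (c i)

  lowerBound>0 : ∀ i → 0 < lookup (value l) i
  lowerBound>0 i = positive l
    where
    positive : (l : S k m) → 0 < lookup (value l) i
    positive (v , [ c ]) = recompute (0 <? lookup v i) (0<coordinate m v c i)

  coord-bound : ∀ x i → lookup (value l) i ≤ coord x i
  coord-bound x@(_ , [ b ]) i = recompute (lookup (value l) i ≤? coord x i) (b i)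

  coord<1+m : ∀ x i → coord x i < suc m
  coord<1+m x = coordinate<1+m m (value (value x)) (ext-chain x)

  ext-last : ∀ x → ext x (suc (fromℕ k)) ≡ suc m
  ext-last x = lookup-∷ʳ-last (value (value x)) (suc m)

  private
    winched : Fin k → S′ l → ℕ
    winched i x = step (before m (value (value x)) i) (coord x i) (after m (value (value x)) i)

    value-lowerWinch : ∀ i x → value (value (lowerWinch l i x)) ≡
                       value (value x) Vec.[ i ]≔ (winched i x ⊔ lookup (value l) i)
    value-lowerWinch i x = Vec.updateAt-updateAt i (value (value x))

  coord-lowerWinch : ∀ i x → coord (lowerWinch l i x) i ≡
    step (ext x (inject₁ (inject₁ i))) (coord x i) (ext x (suc (suc i))) ⊔ lookup (value l) i
  coord-lowerWinch i x = ≡.trans (cong (λ v → lookup v i) (value-lowerWinch i x))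
    (Vec.lookup∘updateAt i (value (value x)))

  ext-lowerWinch : ∀ i x q → q ≢ suc (inject₁ i) → ext (lowerWinch l i x) q ≡ ext x q
  ext-lowerWinch i x q q≢i = ≡.trans
    (cong (λ v → lookup v q) (≡.trans (cong (extend m) (value-lowerWinch i x))
                                      (extend-update m (value (value x)) i _)))
    (Vec.lookup∘updateAt′ q (suc (inject₁ i)) q≢i (extend m (value (value x))))

  module _ (ν : Permutation′ k) (z : ℕ → S′ l)
           (next : ∀ i → z (suc (toℕ i)) ≡ lowerWinch l (ν ⟨$⟩ʳ i) (z (toℕ i))) where

    private
      static : ∀ q → StaticExcept k (turn ν q) (λ j → ext (z j) q)
      static q j j<k j≢turn = subst (λ j → j ≢ turn ν q → ext (z (suc j)) q ≡ ext (z j) q)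
        (Fin.toℕ-fromℕ< j<k) (at (fromℕ< j<k)) j≢turn
        where
        at : ∀ i → toℕ i ≢ turn ν q → ext (z (suc (toℕ i))) q ≡ ext (z (toℕ i)) q
        at i i≢turn = ≡.trans (cong (λ x → ext x q) (next i)) (ext-lowerWinch (ν ⟨$⟩ʳ i) (z (toℕ i)) q
          -- If `q` were the position winched at time `i`, its turn would be ν⁻¹(ν(i)) = i.
          λ { ≡.refl → i≢turn (≡.sym (≡.trans (turn-inner ν (ν ⟨$⟩ʳ i)) (cong toℕ (Permutation.inverseˡ ν)))) })

      initial : ∀ q j → j ≤ k → j ≤ turn ν q → ext (z j) q ≡ ext (z 0) q
      initial q = static-until {h = λ j → ext (z j) q} (static q)

      final : ∀ q j → j ≤ k → turn ν q < j → ext (z j) q ≡ ext (z k) q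
      final q = static-since {h = λ j → ext (z j) q} (static q)

    module _ (i : Fin k) where

      private
        t = toℕ (ν ⟨$⟩ˡ i)

        t<k : t < k
        t<k = Fin.toℕ<n (ν ⟨$⟩ˡ i)

        t≤k = ℕ.<⇒≤ t<k

        left mid right : Fin (suc (suc k))
        left  = inject₁ (inject₁ i)
        mid   = suc (inject₁ i)
        right = suc (suc i)

      -- Every coordinate moves once per round, so at any time it has either its initial or its
      -- final value. A tie, possible only with the left sentinel, falls into the second case, since
      -- `initial` includes the turn itself.
      left-at-turn : ext (z t) left ≡ (if leftFirst ν (inject₁ i) then ext (z k) else ext (z 0)) left
      left-at-turn with turn ν (inject₁ (inject₁ i)) <? turn ν (suc (inject₁ i))
      ... | yes < = final left t t≤k (subst (turn ν left <_) (turn-inner ν i) <)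
      ... | no  ≮ = initial left t t≤k (subst (_≤ turn ν left) (turn-inner ν i) (ℕ.≮⇒≥ ≮))

      right-at-turn : ext (z t) right ≡ (if leftFirst ν (suc i) then ext (z 0) else ext (z k)) right
      right-at-turn with turn ν (suc (inject₁ i)) <? turn ν (suc (suc i))
      ... | yes < = initial right t t≤k (subst (_≤ turn ν right) (turn-inner ν i) (ℕ.<⇒≤ <))
      -- `final` requires the right neighbour to be strictly earlier, hence the appeal to
      -- `turn-adjacent-≢`.
      ... | no  ≮ = final right t t≤k
        (subst (turn ν right <_) (turn-inner ν i) (ℕ.≤∧≢⇒< (ℕ.≮⇒≥ ≮) (turn-adjacent-≢ ν i)))

      coord-at-turn : coord (z t) i ≡ coord (z 0) i
      coord-at-turn = begin
        coord (z t) i   ≡⟨ ext≡coord (z t) i ⟨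
        ext (z t) mid   ≡⟨ initial mid t t≤k (ℕ.≤-reflexive (≡.sym (turn-inner ν i))) ⟩
        ext (z 0) mid   ≡⟨ ext≡coord (z 0) i ⟩
        coord (z 0) i   ∎
        where open ≡-Reasoning

      coord-after-turn : coord (z k) i ≡
        step (ext (z t) left) (coord (z t) i) (ext (z t) right) ⊔ lookup (value l) i
      coord-after-turn = begin
        coord (z k) i                    ≡⟨ ext≡coord (z k) i ⟨
        ext (z k) mid                    ≡⟨ final mid (suc t) t<k (s≤s (ℕ.≤-reflexive (turn-inner ν i))) ⟨
        ext (z (suc t)) mid              ≡⟨ ext≡coord (z (suc t)) i ⟩
        coord (z (suc t)) i              ≡⟨ cong (λ x → coord x i) (next (ν ⟨$⟩ˡ i)) ⟩
        coord (lowerWinch l (ν ⟨$⟩ʳ (ν ⟨$⟩ˡ i)) (z t)) i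
          ≡⟨ cong (λ j → coord (lowerWinch l j (z t)) i) (Permutation.inverseʳ ν) ⟩
        coord (lowerWinch l i (z t)) i   ≡⟨ coord-lowerWinch i (z t) ⟩
        step (ext (z t) left) (coord (z t) i) (ext (z t) right) ⊔ lookup (value l) i ∎
        where open ≡-Reasoning

-- The starting permutation is arbitrary so that the induction can absorb each factor into it.
to-foldl : ∀ {A X : Set} (w : A → X ↔ X) (τ : X ↔ X) is x →
           Inverse.to (foldl (λ τ i → w i ↔-∘ τ) τ is) x ≡ foldl (λ z i → Inverse.to (w i) z) (Inverse.to τ x) is
to-foldl w τ []       x = ≡.refl
to-foldl w τ (i ∷ is) x = to-foldl w (w i ↔-∘ τ) is x

trajectory : ∀ {k m} (l : S k m) (ν : Permutation′ k) (x : S′ l) → ∃ λ (z : ℕ → S′ l) →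
  z 0 ≡ x × z k ≡ Inverse.to (W̲-along l ν) x ×
  (∀ i → z (suc (toℕ i)) ≡ lowerWinch l (ν ⟨$⟩ʳ i) (z (toℕ i)))
trajectory {k} l ν x =
  let z , start , end , next = foldl-trajectory (λ z i → Inverse.to (W̲ l (ν ⟨$⟩ʳ i)) z) k (λ i → i) x
  in z , start , ≡.trans end (≡.sym (to-foldl (λ i → W̲ l (ν ⟨$⟩ʳ i)) (↔-id (S′ l)) (allFin k) x)) , next

-- The coboundary identity over an arbitrary abelian group.

module _ {c ℓ : Level} (G : AbelianGroup c ℓ) where

  open AbelianGroup G renaming (_≈_ to _≃_)
  open AbelianGroupProperties G using (∙-cancelʳ)
  open CommutativeSemigroupProperties commutativeSemigroup using (xy∙z≈xz∙y)
  open Sum commutativeMonoid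
  open CommutativeMonoidSolver commutativeMonoid using (solve; _⊕_; _⊜_)
  open SetoidReasoning setoid

  sum-difference : ∀ {n} (s t : Fin n → Carrier) → ∑[ i < n ] (s i ∙ t i ⁻¹) ≃ sum s ∙ sum t ⁻¹
  sum-difference s t = ∙-cancelʳ (sum t) _ _ $ begin
    sum (λ i → s i ∙ t i ⁻¹) ∙ sum t    ≈⟨ ∑-distrib-+ (λ i → s i ∙ t i ⁻¹) t ⟨
    sum (λ i → s i ∙ t i ⁻¹ ∙ t i)      ≈⟨ sum-cong-≋ (λ i → x∙y⁻¹∙y≃x (s i) (t i)) ⟩
    sum s                              ≈⟨ x∙y⁻¹∙y≃x (sum s) (sum t) ⟨
    sum s ∙ sum t ⁻¹ ∙ sum t            ∎
    where
    x∙y⁻¹∙y≃x : ∀ x y → x ∙ y ⁻¹ ∙ y ≃ x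
    x∙y⁻¹∙y≃x x y = trans (assoc x (y ⁻¹) y) (trans (∙-congˡ (inverseˡ y)) (identityʳ x))

  cross-difference : ∀ x y u v → x ∙ v ≃ u ∙ y → x ∙ y ⁻¹ ≃ u ∙ v ⁻¹
  cross-difference x y u v eq = ∙-cancelʳ (y ∙ v) _ _ $ begin
    x ∙ y ⁻¹ ∙ (y ∙ v)    ≈⟨ solve 4 (λ x y y′ v → (x ⊕ y′) ⊕ (y ⊕ v) ⊜ (x ⊕ v) ⊕ (y′ ⊕ y)) refl x y (y ⁻¹) v ⟩
    x ∙ v ∙ (y ⁻¹ ∙ y)    ≈⟨ ∙-cong eq (trans (inverseˡ y) (sym (inverseˡ v))) ⟩
    u ∙ y ∙ (v ⁻¹ ∙ v)    ≈⟨ solve 4 (λ u y v v′ → (u ⊕ y) ⊕ (v′ ⊕ v) ⊜ (u ⊕ v′) ⊕ (y ⊕ v)) refl u y v (v ⁻¹) ⟩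
    u ∙ v ⁻¹ ∙ (y ∙ v)    ∎

  telescope : ∀ n (s t : ℕ → Carrier) → (∀ j → s j ∙ t (suc j) ≃ t j) →
              ∑[ j < n ] s (toℕ j) ∙ t n ≃ t 0
  telescope zero    s t step = identityˡ (t 0)
  telescope (suc n) s t step = begin
    s 0 ∙ ∑[ j < n ] s (suc (toℕ j)) ∙ t (suc n)   ≈⟨ assoc _ _ _ ⟩
    s 0 ∙ (∑[ j < n ] s (suc (toℕ j)) ∙ t (suc n)) ≈⟨ ∙-congˡ (telescope n (s ∘ suc) (t ∘ suc) (step ∘ suc)) ⟩
    s 0 ∙ t 1                                      ≈⟨ step 0 ⟩
    t 0                                            ∎

  module _ (m : ℕ) (φ : ℕ → Carrier) where

    -- This is F. Counting `suc m ∸ v` summands makes the sum empty at `suc m`, the value of the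
    -- right sentinel.
    upperSum : ℕ → Carrier
    upperSum v = ∑[ j < suc m ∸ v ] φ (v + toℕ j)

    upperSum-inside : ∀ v → v < suc m → upperSum v ≡ ∑[ j < suc (m ∸ v) ] φ (v + toℕ j)
    upperSum-inside v v<1+m rewrite ℕ.+-∸-assoc 1 (s≤s⁻¹ v<1+m) = ≡.refl

    upperSum-suc : ∀ v → v < suc m → upperSum v ≃ φ v ∙ upperSum (suc v)
    upperSum-suc v v<1+m = reflexive (≡.trans (upperSum-inside v v<1+m) (≡.cong₂ _∙_
      (cong φ (ℕ.+-identityʳ v)) (sum-cong-≗ {m ∸ v} (λ j → cong φ (ℕ.+-suc v (toℕ j))))))

    upperSum-end : upperSum (suc m) ≃ ε
    upperSum-end rewrite ℕ.n∸n≡0 m = refl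

    contact : ℕ → ℕ → Carrier
    contact u v = if ⌊ v ≟ suc u ⌋ then upperSum v else ε

    contact-≡ : ∀ u v → v ≡ suc u → contact u v ≃ upperSum v
    contact-≡ u v eq with v ≟ suc u
    ... | yes _ = refl
    ... | no ≢  = contradiction eq ≢

    contact-≢ : ∀ u v → v ≢ suc u → contact u v ≃ ε
    contact-≢ u v ≢ with v ≟ suc u
    ... | yes eq = contradiction eq ≢
    ... | no _   = refl

    contact-vanishes : ∀ u v → upperSum v ≃ ε → contact u v ≃ ε
    contact-vanishes u v ≈0 with v ≟ suc u
    ... | yes _ = ≈0
    ... | no  _ = refl

    -- If the coordinate can advance, its new value is `suc a`, already at least `b`, and neither
    -- pair is in contact. Otherwise `t` is `suc a`, so the contact on the right is F(a + 1), and
    -- the value falls back to `suc p ⊔ b`. There the contact on the left equals F: either the new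
    -- value touches `p`, or it is `b`, where F vanishes.
    winch-balance : ∀ {p a t b} → p < a → a < t → b ≤ a → upperSum b ≃ ε →
      upperSum (suc a) ∙ contact p (step p a t ⊔ b) ≃ upperSum (step p a t ⊔ b) ∙ contact a t
    winch-balance {p} {a} {t} {b} p<a a<t b≤a b≈0 with suc a <? t
    ... | yes 1+a<t rewrite ℕ.m≥n⇒m⊔n≡m (ℕ.m≤n⇒m≤1+n b≤a) = ∙-congˡ (trans
      (contact-≢ p (suc a) (ℕ.>⇒≢ p<a ∘ ℕ.suc-injective)) (sym (contact-≢ a t (ℕ.>⇒≢ 1+a<t))))
    ... | no 1+a≮t with ℕ.≤-antisym (ℕ.≮⇒≥ 1+a≮t) a<t
    ...   | ≡.refl = begin
      upperSum (suc a) ∙ contact p (suc p ⊔ b)   ≈⟨ comm _ _ ⟩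
      contact p (suc p ⊔ b) ∙ upperSum (suc a)   ≈⟨ ∙-cong reset (sym (contact-≡ a (suc a) ≡.refl)) ⟩
      upperSum (suc p ⊔ b) ∙ contact a (suc a)   ∎
      where
      reset : contact p (suc p ⊔ b) ≃ upperSum (suc p ⊔ b)
      reset with b ≤? suc p
      ... | yes b≤ = contact-≡ p (suc p ⊔ b) (ℕ.m≥n⇒m⊔n≡m b≤)
      -- The lower bound overrides the reset to `suc p`; F(b) = 0 makes both sides trivial.
      ... | no  b≰ rewrite ℕ.m≤n⇒m⊔n≡n (ℕ.<⇒≤ (ℕ.≰⇒> b≰)) = trans (contact-vanishes p b b≈0) (sym b≈0)

    -- A first coordinate touching the sentinel 0 equals 1, which forces the first lower bound to be
    -- 1 as well, and F vanishes there. For `k` = 0 the neighbour is `suc m`, where F is an empty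
    -- sum.
    contact-first : ∀ {k} (l : S k m) → (∀ i → upperSum (lookup (value l) i) ≃ ε) →
                    ∀ x → contact 0 (ext l x (suc zero)) ≃ ε
    contact-first {zero}  l l≈0 ((Vec.[] , _) , _) = contact-vanishes 0 (suc m) upperSum-end
    contact-first {suc k} l l≈0 x@((_ Vec.∷ _ , _) , _) with coord l x zero ≟ 1
    ... | no  ≢1 = refl
    ... | yes ≡1 = trans (reflexive (cong upperSum (≡.trans ≡1
      (ℕ.≤-antisym (lowerBound>0 l zero) (ℕ.≤-trans (coord-bound l x zero) (ℕ.≤-reflexive ≡1)))))) (l≈0 zero)

    module _ {k : ℕ} (l : S k m) (ν : Permutation′ k) where

      earlyContact : S′ l → Fin (suc k) → Carrier
      earlyContact x e = if leftFirst ν e then contact (ext l x (inject₁ e)) (ext l x (suc e)) else ε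

      -- This is Ψ. The subtracted contacts are those surviving the cancellation over a round,
      -- indexed by the right edges of the coordinates; the one other edge, `zero`, is covered by
      -- `contact-first`.
      potential : S′ l → Carrier
      potential x = ∑[ i < k ] upperSum (coord l x i) ∙ (∑[ i < k ] earlyContact x (suc i)) ⁻¹

      module _ (l≈0 : ∀ i → upperSum (lookup (value l) i) ≃ ε) (z : ℕ → S′ l)
               (next : ∀ i → z (suc (toℕ i)) ≡ lowerWinch l (ν ⟨$⟩ʳ i) (z (toℕ i))) where

        private
          x = z 0
          y = z k

          -- The contact at edge e just before its left end is winched, and just
          -- after its right end is winched.
          old new : Fin (suc k) → Carrier
          old e = contact (ext l x (inject₁ e)) ((if leftFirst ν e then ext l x else ext l y) (suc e))
          new e = contact ((if leftFirst ν e then ext l y else ext l x) (inject₁ e)) (ext l y (suc e))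

          -- If the left end moves first, `old` is read off `x` alone and `new` off `y` alone, so
          -- they are the early contacts themselves. Otherwise `old` and `new` coincide and there is
          -- no early contact.
          old-new : ∀ e → old e ∙ earlyContact y e ≃ new e ∙ earlyContact x e
          old-new e with leftFirst ν e
          ... | true  = comm _ _
          ... | false = refl

          -- This is `winch-balance` at the turn of `i`. Its left edge has then just had its right
          -- end winched, giving `new`; its right edge is about to have its left end winched, giving
          -- `old`.
          vertex : ∀ i → upperSum (suc (coord l x i)) ∙ new (inject₁ i) ≃ upperSum (coord l y i) ∙ old (suc i)
          vertex i = begin
            upperSum (suc (coord l x i)) ∙ new (inject₁ i)
              ≡⟨ ≡.cong₂ _∙_ (cong (upperSum ∘ suc) (coord-at-turn l ν z next i))
                   (≡.cong₂ contact (left-at-turn l ν z next i)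
                     (≡.trans (≡.sym (coord-after-turn l ν z next i)) (≡.sym (ext≡coord l y i)))) ⟨
            upperSum (suc a) ∙ contact p (step p a t ⊔ b)
              ≈⟨ winch-balance (before< m v (ext-chain l w) i) (<after m v (ext-chain l w) i) (coord-bound l w i) (l≈0 i) ⟩
            upperSum (step p a t ⊔ b) ∙ contact a t
              ≡⟨ ≡.cong₂ _∙_ (cong upperSum (≡.sym (coord-after-turn l ν z next i)))
                   (≡.cong₂ contact (≡.trans (coord-at-turn l ν z next i) (≡.sym (ext≡coord l x i)))
                     (right-at-turn l ν z next i)) ⟩
            upperSum (coord l y i) ∙ old (suc i)
              ∎
            where
            w = z (toℕ (ν ⟨$⟩ˡ i))
            v = value (value w)
            p = ext l w (inject₁ (inject₁ i))
            a = coord l w i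
            t = ext l w (suc (suc i))
            b = lookup (value l) i

          new-first : new zero ≃ ε
          -- The left sentinel is 0 in both tuples; the split only makes the conditional reduce.
          new-first with leftFirst ν zero
          ... | true  = contact-first l l≈0 y
          ... | false = contact-first l l≈0 y

          new-last : new (fromℕ k) ≃ ε
          new-last = contact-vanishes _ (ext l y (suc (fromℕ k))) (trans (reflexive (cong upperSum (ext-last l y))) upperSum-end)

          -- Left edges and right edges of the coordinates differ only by the two end edges, where
          -- `new` vanishes.
          new-shift : ∑[ i < k ] new (inject₁ i) ≃ ∑[ i < k ] new (suc i)
          new-shift = begin
            ∑[ i < k ] new (inject₁ i)                  ≈⟨ identityʳ _ ⟨
            ∑[ i < k ] new (inject₁ i) ∙ ε             ≈⟨ ∙-congˡ new-last ⟨
            ∑[ i < k ] new (inject₁ i) ∙ new (fromℕ k)  ≈⟨ sum-init-last new ⟨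
            new zero ∙ ∑[ i < k ] new (suc i)           ≈⟨ ∙-congʳ new-first ⟩
            ε ∙ ∑[ i < k ] new (suc i)                 ≈⟨ identityˡ _ ⟩
            ∑[ i < k ] new (suc i)                      ∎

          Fx⁺ = ∑[ i < k ] upperSum (suc (coord l x i))
          Fx  = ∑[ i < k ] upperSum (coord l x i)
          Fy  = ∑[ i < k ] upperSum (coord l y i)
          Ex  = ∑[ i < k ] earlyContact x (suc i)
          Ey  = ∑[ i < k ] earlyContact y (suc i)
          s   = ∑[ i < k ] φ (coord l x i)

          -- Adding up `vertex` yields `n₀` on one side and `o₁` on the other; `old-new` trades `o₁`
          -- for `n₁` and the early contacts, and `new-shift` lets `n₀` cancel.
          summed : Fx⁺ ∙ Ey ≃ Fy ∙ Ex
          summed = ∙-cancelʳ n₀ _ _ $ begin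
            Fx⁺ ∙ Ey ∙ n₀    ≈⟨ xy∙z≈xz∙y Fx⁺ Ey n₀ ⟩
            Fx⁺ ∙ n₀ ∙ Ey    ≈⟨ ∙-congʳ (sums-≃ (λ i → upperSum (suc (coord l x i))) _ _ _ vertex) ⟩
            Fy ∙ o₁ ∙ Ey    ≈⟨ assoc _ _ _ ⟩
            Fy ∙ (o₁ ∙ Ey)  ≈⟨ ∙-congˡ (sums-≃ (old ∘ suc) _ _ _ (old-new ∘ suc)) ⟩
            Fy ∙ (n₁ ∙ Ex)  ≈⟨ ∙-congˡ (∙-congʳ new-shift) ⟨
            Fy ∙ (n₀ ∙ Ex)  ≈⟨ ∙-congˡ (comm n₀ Ex) ⟩
            Fy ∙ (Ex ∙ n₀)  ≈⟨ assoc _ _ _ ⟨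
            Fy ∙ Ex ∙ n₀    ∎
            where
            n₀ = ∑[ i < k ] new (inject₁ i)
            n₁ = ∑[ i < k ] new (suc i)
            o₁ = ∑[ i < k ] old (suc i)
            sums-≃ : (a b c d : Fin k → Carrier) → (∀ i → a i ∙ b i ≃ c i ∙ d i) → sum a ∙ sum b ≃ sum c ∙ sum d
            sums-≃ a b c d eq = begin
              sum a ∙ sum b            ≈⟨ ∑-distrib-+ a b ⟨
              sum (λ i → a i ∙ b i)    ≈⟨ sum-cong-≋ eq ⟩
              sum (λ i → c i ∙ d i)    ≈⟨ ∑-distrib-+ c d ⟩
              sum c ∙ sum d            ∎

        -- By `summed`, Ψ after the round is the sum of the F(x_i + 1) minus the early contacts of
        -- `x`. Adding each φ(x_i) turns F(x_i + 1) into F(x_i), which gives Ψ before the round.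
        coboundary-along : ∑[ i < k ] φ (coord l (z 0) i) ∙ potential (z k) ≃ potential (z 0)
        coboundary-along = begin
          s ∙ (Fy ∙ Ey ⁻¹)                ≈⟨ ∙-congˡ (cross-difference Fy Ey Fx⁺ Ex (sym summed)) ⟩
          s ∙ (Fx⁺ ∙ Ex ⁻¹)                ≈⟨ assoc _ _ _ ⟨
          s ∙ Fx⁺ ∙ Ex ⁻¹                  ≈⟨ ∙-congʳ (∑-distrib-+ (λ i → φ (coord l x i)) _) ⟨
          ∑[ i < k ] (φ (coord l x i) ∙ upperSum (suc (coord l x i))) ∙ Ex ⁻¹
                                         ≈⟨ ∙-congʳ (sum-cong-≋ (λ i → upperSum-suc _ (coord<1+m l x i))) ⟨
          Fx ∙ Ex ⁻¹                      ∎

      coboundary : (∀ i → upperSum (lookup (value l) i) ≃ ε) → ∀ x →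
        ∑[ i < k ] φ (coord l x i) ∙ potential (Inverse.to (W̲-along l ν) x) ≃ potential x
      coboundary l≈0 x =
        let z , start , end , next = trajectory l ν x
        in subst₂ (λ x y → ∑[ i < k ] φ (coord l x i) ∙ potential y ≃ potential x)
             start end (coboundary-along l≈0 z next)

-- Orbits of a permutation of a finite set.

least : ∀ {P : ℕ → Set} → Decidable P → ∀ n → P n → ∃ λ r → P r × (∀ j → j < r → ¬ P j)
least P? zero    p = 0 , p , λ _ ()
least P? (suc n) p with P? 0
... | yes p₀ = 0 , p₀ , λ _ ()
... | no ¬p₀ with least (P? ∘ suc) n p
...   | r , pᵣ , below = suc r , pᵣ , λ { zero _ → ¬p₀ ; (suc j) (s≤s j<r) → below j j<r }

module _ {X : Set} (τ : X ↔ X) {N : ℕ} (encode : X → Fin N) (encode-injective : Injective _≡_ _≡_ encode) where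

  private
    t = Inverse.to τ

    iter : X → ℕ → X
    iter x = fold x t

    t-injective : ∀ {x y} → t x ≡ t y → x ≡ y
    t-injective {x} {y} eq = begin
      x                         ≡⟨ Inverse.strictlyInverseʳ τ x ⟨
      Inverse.from τ (t x)      ≡⟨ cong (Inverse.from τ) eq ⟩
      Inverse.from τ (t y)      ≡⟨ Inverse.strictlyInverseʳ τ y ⟩
      y                         ∎
      where open ≡-Reasoning

    iter-cancel : ∀ x a {b} → iter x (a + b) ≡ iter x a → iter x b ≡ x
    iter-cancel x zero    eq = eq
    iter-cancel x (suc a) eq = iter-cancel x a (t-injective eq)

    -- The return time `b ∸ a` is written as a successor to exhibit it as positive.
    iter-collision : ∀ x {a b} → a < b → iter x a ≡ iter x b → iter x (suc (b ∸ suc a)) ≡ x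
    iter-collision x {a} {b} a<b eq = iter-cancel x a (≡.trans
      (cong (iter x) (≡.trans (ℕ.+-suc a (b ∸ suc a)) (ℕ.m+[n∸m]≡n a<b))) (≡.sym eq))

    returns : ∀ x → ∃ λ n → iter x (suc n) ≡ x
    returns x with Fin.pigeonhole (ℕ.n<1+n N) (encode ∘ iter x ∘ toℕ)
    ... | i , j , i<j , eq = toℕ j ∸ suc (toℕ i) , iter-collision x i<j (encode-injective eq)

    iter-multiple : ∀ x p → iter x p ≡ x → ∀ q → iter x (q * p) ≡ x
    iter-multiple x p eq zero    = ≡.refl
    iter-multiple x p eq (suc q) = ≡.trans (fold-+ x t p)
      (≡.trans (cong (λ y → iter y p) (iter-multiple x p eq q)) eq)

  -- The size is the least positive return time, so a repetition among the listed iterates would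
  -- give a shorter one. The two extra facts, the order of the listing and its closing up, are what
  -- telescoping along the orbit uses.
  cyclicOrbit : ∀ x → Σ (Orbit τ x) λ O →
                (∀ j → element O j ≡ fold x t (toℕ j)) × fold x t (size O) ≡ x
  cyclicOrbit x with returns x
  -- Equality in `X` is decided through the injective encoding; `r` stands for the return time
  -- `suc r`.
  ... | n , back with least (λ r → map′ encode-injective (cong encode) (encode (iter x (suc r)) Fin.≟ encode x)) n back
  ...   | r , period , minimal = record
    { size       = suc r
    ; element    = iter x ∘ toℕ
    ; injective  = λ {i} {j} eq → Fin.toℕ-injective (unrepeated i j eq)
    ; exhaustive = λ y → mk⇔
        (λ (j , eq) → toℕ j , eq)
        (λ (n , eq) → fromℕ< (m%n<n n (suc r)) , ≡.trans (reduce n) eq)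
    } , (λ _ → ≡.refl) , period
    where
    no-collision : ∀ {a} (j : Fin (suc r)) → a < toℕ j → ¬ iter x a ≡ iter x (toℕ j)
    no-collision {a} j a<j eq = minimal (toℕ j ∸ suc a)
      (ℕ.<-≤-trans (ℕ.∸-monoʳ-< {toℕ j} (s≤s z≤n) a<j) (ℕ.≤-pred (Fin.toℕ<n j)))
      (iter-collision x a<j eq)

    unrepeated : ∀ (i j : Fin (suc r)) → iter x (toℕ i) ≡ iter x (toℕ j) → toℕ i ≡ toℕ j
    unrepeated i j eq with ℕ.<-cmp (toℕ i) (toℕ j)
    ... | tri< i<j _ _ = contradiction eq (no-collision j i<j)
    ... | tri≈ _ i≡j _ = i≡j
    ... | tri> _ _ j<i = contradiction (≡.sym eq) (no-collision i j<i)

    reduce : ∀ n → iter x (toℕ (fromℕ< (m%n<n n (suc r)))) ≡ iter x n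
    reduce n = begin
      iter x (toℕ (fromℕ< (m%n<n n (suc r))))          ≡⟨ cong (iter x) (Fin.toℕ-fromℕ< (m%n<n n (suc r))) ⟩
      iter x (n % suc r)                               ≡⟨ cong (λ y → iter y (n % suc r)) (iter-multiple x (suc r) period (n / suc r)) ⟨
      iter (iter x (n / suc r * suc r)) (n % suc r)    ≡⟨ fold-+ x t (n % suc r) ⟨
      iter x (n % suc r + n / suc r * suc r)           ≡⟨ cong (iter x) (m≡m%n+[m/n]*n n (suc r)) ⟨
      iter x n                                         ∎
      where open ≡-Reasoning

module _ {k m : ℕ} (l : S k m) where

  encode : S′ l → Fin (suc m ^ k)
  encode x = funToFin (λ i → fromℕ< (coord<1+m l x i))

  encode-injective : Injective _≡_ _≡_ encode
  encode-injective {x} {y} eq = value-injective (value-injective (Pointwise.Pointwise-≡⇒≡ (Pointwise.ext same)))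
    where
    same : ∀ i → coord l x i ≡ coord l y i
    same i = Fin.fromℕ<-injective _ _ (coord<1+m l x i) (coord<1+m l y i) (begin
      fromℕ< (coord<1+m l x i)    ≡⟨ Fin.finToFun-funToFin _ i ⟨
      finToFun (encode x) i       ≡⟨ cong (λ n → finToFun n i) eq ⟩
      finToFun (encode y) i       ≡⟨ Fin.finToFun-funToFin _ i ⟩
      fromℕ< (coord<1+m l y i)    ∎)
      where open ≡-Reasoning

-- Rational sequences modulo null sequences, and averages.

open +-*-Solver using (solve; _:+_; _:-_; :-_; _:*_; _:=_; con)

Sequence : Set
Sequence = ℕ → ℚ

Null : Sequence → Set
Null s = ∀ ε → 0ℚ ℚ.< ε → ∃ λ N → ∀ i → N ≤ i → ℚ.∣ s i ∣ ℚ.< ε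

null-≗ : ∀ {s} t → (∀ i → s i ≡ t i) → Null s → Null t
null-≗ t s≗t null ε ε>0 with null ε ε>0
... | N , small = N , λ i N≤i → subst (λ q → ℚ.∣ q ∣ ℚ.< ε) (s≗t i) (small i N≤i)

null-dominated : ∀ s t → (∀ i → ℚ.∣ t i ∣ ℚ.≤ ℚ.∣ s i ∣) → Null s → Null t
null-dominated s t t≤s null ε ε>0 with null ε ε>0
... | N , small = N , λ i N≤i → ℚ.≤-<-trans (t≤s i) (small i N≤i)

null-0 : Null (λ _ → 0ℚ)
null-0 ε ε>0 = 0 , λ _ _ → ε>0

null-+ : ∀ s t → Null s → Null t → Null (λ i → s i ℚ.+ t i)
null-+ s t s-null t-null ε ε>0
  with s-null (½ ℚ.* ε) (0<½ε ε>0) | t-null (½ ℚ.* ε) (0<½ε ε>0)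
... | M , s-small | N , t-small = M ⊔ N , λ i i≥ → begin-strict
  ℚ.∣ s i ℚ.+ t i ∣             ≤⟨ ℚ.∣p+q∣≤∣p∣+∣q∣ (s i) (t i) ⟩
  ℚ.∣ s i ∣ ℚ.+ ℚ.∣ t i ∣       <⟨ ℚ.+-mono-< (s-small i (ℕ.m⊔n≤o⇒m≤o M N i≥)) (t-small i (ℕ.m⊔n≤o⇒n≤o M N i≥)) ⟩
  ½ ℚ.* ε ℚ.+ ½ ℚ.* ε           ≡⟨ ½ε+½ε≡ε ε ⟩
  ε                             ∎
  where open ℚ.≤-Reasoning

null-neg : ∀ s → Null s → Null (λ i → ℚ.- s i)
null-neg s = null-dominated s _ (λ i → ℚ.≤-reflexive (ℚ.∣-p∣≡∣p∣ (s i)))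

-- On the underlying sequences this is, by definition, the equality of ℝ.
infix 4 _≋_
_≋_ : Sequence → Sequence → Set
s ≋ t = Null (λ i → s i ℚ.- t i)

≗⇒≋ : ∀ s t → (∀ i → s i ≡ t i) → s ≋ t
≗⇒≋ s t s≗t = null-≗ _ (λ i → ≡.sym (≡.trans (cong (ℚ._- t i) (s≗t i)) (ℚ.+-inverseʳ (t i)))) null-0

sequenceGroup : AbelianGroup 0ℓ 0ℓ
sequenceGroup = record
  { Carrier = Sequence
  ; _≈_ = _≋_
  ; _∙_ = λ s t i → s i ℚ.+ t i
  ; ε = λ _ → 0ℚ
  ; _⁻¹ = λ s i → ℚ.- s i
  ; isAbelianGroup = record
    { isGroup = record
      { isMonoid = record
        { isSemigroup = record
          { isMagma = record
            { isEquivalence = record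
              { refl  = λ {s} → ≗⇒≋ s s (λ _ → ≡.refl)
              ; sym   = λ {s} {t} s≋t → null-≗ _ (λ i → neg-difference (s i) (t i)) (null-neg _ s≋t)
              ; trans = λ {s} {t} {u} s≋t t≋u → null-≗ _ (λ i → differences (s i) (t i) (u i)) (null-+ _ _ s≋t t≋u)
              }
            ; ∙-cong = λ {s} {s′} {t} {t′} s≋s′ t≋t′ →
                null-≗ _ (λ i → interchange (s i) (s′ i) (t i) (t′ i)) (null-+ _ _ s≋s′ t≋t′)
            }
          ; assoc = λ s t u → ≗⇒≋ _ _ (λ i → ℚ.+-assoc (s i) (t i) (u i))
          }
        ; identity = (λ s → ≗⇒≋ _ _ (λ i → ℚ.+-identityˡ (s i))) , (λ s → ≗⇒≋ _ _ (λ i → ℚ.+-identityʳ (s i)))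
        }
      ; inverse = (λ s → ≗⇒≋ _ _ (λ i → ℚ.+-inverseˡ (s i))) , (λ s → ≗⇒≋ _ _ (λ i → ℚ.+-inverseʳ (s i)))
      ; ⁻¹-cong = λ {s} {t} s≋t → null-≗ _ (λ i → ℚ.neg-distrib-+ (s i) (ℚ.- t i)) (null-neg _ s≋t)
      }
    ; comm = λ s t → ≗⇒≋ _ _ (λ i → ℚ.+-comm (s i) (t i))
    }
  }
  where
  neg-difference : ∀ p q → ℚ.- (p ℚ.- q) ≡ q ℚ.- p
  neg-difference = solve 2 (λ p q → :- (p :- q) := q :- p) ≡.refl
  differences : ∀ p q r → (p ℚ.- q) ℚ.+ (q ℚ.- r) ≡ p ℚ.- r
  differences = solve 3 (λ p q r → (p :- q) :+ (q :- r) := p :- r) ≡.refl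
  interchange : ∀ p p′ q q′ → (p ℚ.- p′) ℚ.+ (q ℚ.- q′) ≡ (p ℚ.+ q) ℚ.- (p′ ℚ.+ q′)
  interchange = solve 4 (λ p p′ q q′ → (p :- p′) :+ (q :- q′) := (p :+ q) :- (p′ :+ q′)) ≡.refl

-- The recursion follows the induction on the number of summands in `deviation-expand`.
ℕ⇒ℚ : ℕ → ℚ
ℕ⇒ℚ zero    = 0ℚ
ℕ⇒ℚ (suc n) = 1ℚ ℚ.+ ℕ⇒ℚ n

ℕ⇒ℚ≡/1 : ∀ n → ℕ⇒ℚ n ≡ + n ℚ./ 1
ℕ⇒ℚ≡/1 zero    = ≡.refl
ℕ⇒ℚ≡/1 (suc n) = ≡.trans (cong (1ℚ ℚ.+_) (ℕ⇒ℚ≡/1 n)) $ ℚ.toℚᵘ-injective $ begin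
  ℚ.toℚᵘ (1ℚ ℚ.+ + n ℚ./ 1)               ≈⟨ ℚ.toℚᵘ-homo-+ 1ℚ (+ n ℚ./ 1) ⟩
  ℚᵘ.1ℚᵘ ℚᵘ.+ ℚ.toℚᵘ (+ n ℚ./ 1)          ≈⟨ ℚᵘ.+-congʳ ℚᵘ.1ℚᵘ (ℚ.toℚᵘ-fromℚᵘ (ℚᵘ.mkℚᵘ (+ n) 0)) ⟩
  ℚᵘ.1ℚᵘ ℚᵘ.+ ℚᵘ.mkℚᵘ (+ n) 0             ≈⟨ ℚᵘ.*≡* (cong (λ i → (+ 1 ℤ.+ i) ℤ.* + 1) (ℤ.*-identityʳ (+ n))) ⟩
  ℚᵘ.mkℚᵘ (+ suc n) 0                     ≈⟨ ℚ.toℚᵘ-fromℚᵘ (ℚᵘ.mkℚᵘ (+ suc n) 0) ⟨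
  ℚ.toℚᵘ (+ suc n ℚ./ 1)                  ∎
  where open ℚᵘ.≃-Reasoning

ℕ⇒ℚ*1/n≡1 : ∀ n .{{_ : NonZero n}} → ℕ⇒ℚ n ℚ.* (+ 1 ℚ./ n) ≡ 1ℚ
ℕ⇒ℚ*1/n≡1 n@(suc n-1) = ≡.trans (cong (ℚ._* (+ 1 ℚ./ n)) (ℕ⇒ℚ≡/1 n)) $ ℚ.toℚᵘ-injective $ begin
  ℚ.toℚᵘ (+ n ℚ./ 1 ℚ.* (+ 1 ℚ./ n))             ≈⟨ ℚ.toℚᵘ-homo-* (+ n ℚ./ 1) (+ 1 ℚ./ n) ⟩
  ℚ.toℚᵘ (+ n ℚ./ 1) ℚᵘ.* ℚ.toℚᵘ (+ 1 ℚ./ n)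
    ≈⟨ ℚᵘ.*-cong (ℚ.toℚᵘ-fromℚᵘ (ℚᵘ.mkℚᵘ (+ n) 0)) (ℚ.toℚᵘ-fromℚᵘ (ℚᵘ.mkℚᵘ (+ 1) n-1)) ⟩
  ℚᵘ.mkℚᵘ (+ n) 0 ℚᵘ.* ℚᵘ.mkℚᵘ (+ 1) n-1         ≈⟨ ℚᵘ.*-inverseʳ (ℚᵘ.mkℚᵘ (+ n) 0) ⟩
  ℚᵘ.1ℚᵘ                                         ∎
  where open ℚᵘ.≃-Reasoning

open AbelianGroup sequenceGroup using (setoid; identityˡ) renaming (_∙_ to _+ₛ_; _⁻¹ to -ₛ_; ε to 0ₛ)
open AbelianGroupProperties sequenceGroup using (∙-cancelʳ)
open Sum (AbelianGroup.commutativeMonoid sequenceGroup) using (sum; sum-cong-≗; sum-cong-≋)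

seq-sumℝ : ∀ {n} (a : Fin n → ℝ) → seq (sumℝ a) ≡ sum (seq ∘ a)
seq-sumℝ {zero}  a = ≡.refl
seq-sumℝ {suc n} a = cong (seq (a zero) +ₛ_) (seq-sumℝ (a ∘ suc))

null-ℕ⇒ℚ* : ∀ n {s} → Null s → Null (λ i → ℕ⇒ℚ n ℚ.* s i)
null-ℕ⇒ℚ* zero    {s} null = null-≗ _ (λ i → ≡.sym (ℚ.*-zeroˡ (s i))) null-0
null-ℕ⇒ℚ* (suc n) {s} null = null-≗ _ (λ i → expand (ℕ⇒ℚ n) (s i)) (null-+ _ _ null (null-ℕ⇒ℚ* n null))
  where
  expand : ∀ p q → q ℚ.+ p ℚ.* q ≡ (1ℚ ℚ.+ p) ℚ.* q
  expand = solve 2 (λ p q → q :+ p :* q := (con 1ℚ :+ p) :* q) ≡.refl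

null-1/n* : ∀ n .{{_ : NonZero n}} {s} → Null s → Null (λ i → + 1 ℚ./ n ℚ.* s i)
null-1/n* n {s} = null-dominated s _ λ i → let instance _ = ℚ.nonNegative (ℚ.0≤∣p∣ (s i)) in begin
  ℚ.∣ + 1 ℚ./ n ℚ.* s i ∣           ≡⟨ ℚ.∣p*q∣≡∣p∣*∣q∣ (+ 1 ℚ./ n) (s i) ⟩
  ℚ.∣ + 1 ℚ./ n ∣ ℚ.* ℚ.∣ s i ∣     ≡⟨ cong (ℚ._* ℚ.∣ s i ∣) (ℚ.0≤p⇒∣p∣≡p (0≤1/n n)) ⟩
  + 1 ℚ./ n ℚ.* ℚ.∣ s i ∣           ≤⟨ ℚ.*-monoʳ-≤-nonNeg ℚ.∣ s i ∣ (1/n≤1 n) ⟩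
  1ℚ ℚ.* ℚ.∣ s i ∣                  ≡⟨ ℚ.*-identityˡ ℚ.∣ s i ∣ ⟩
  ℚ.∣ s i ∣                         ∎
  where open ℚ.≤-Reasoning

module _ {n : ℕ} .{{_ : NonZero n}} (a : Fin n → ℝ) (d : ℝ) where

  private
    deviation : Sequence
    deviation = sum (λ j → seq (a j) +ₛ -ₛ seq d)

    deviation-expand : ∀ {n} (a : Fin n → Sequence) (d : Sequence) i →
      sum (λ j → a j +ₛ -ₛ d) i ≡ sum a i ℚ.- ℕ⇒ℚ n ℚ.* d i
    deviation-expand {zero}  a d i = solve 1 (λ d → con 0ℚ := con 0ℚ :- con 0ℚ :* d) ≡.refl (d i)
    deviation-expand {suc n} a d i = ≡.trans
      (cong (a zero i ℚ.- d i ℚ.+_) (deviation-expand (a ∘ suc) d i))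
      (solve 4 (λ a₀ d s n → (a₀ :- d) :+ (s :- n :* d) := (a₀ :+ s) :- (con 1ℚ :+ n) :* d) ≡.refl
        (a zero i) (d i) (sum (a ∘ suc) i) (ℕ⇒ℚ n))

    -- An exact identity at every index. Passing between averages and total deviations then amounts
    -- to multiplying a null sequence by `n` or by 1/n.
    deviation-average : ∀ i → deviation i ≡ ℕ⇒ℚ n ℚ.* (seq (average a) i ℚ.- seq d i)
    deviation-average i = begin
      deviation i                                 ≡⟨ deviation-expand (seq ∘ a) (seq d) i ⟩
      sum (seq ∘ a) i ℚ.- N ℚ.* D                 ≡⟨ cong (λ s → s i ℚ.- N ℚ.* D) (seq-sumℝ a) ⟨
      A ℚ.- N ℚ.* D                               ≡⟨ cong (ℚ._- N ℚ.* D) (ℚ.*-identityˡ A) ⟨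
      1ℚ ℚ.* A ℚ.- N ℚ.* D                        ≡⟨ cong (λ q → q ℚ.* A ℚ.- N ℚ.* D) (ℕ⇒ℚ*1/n≡1 n) ⟨
      N ℚ.* (+ 1 ℚ./ n) ℚ.* A ℚ.- N ℚ.* D
        ≡⟨ solve 4 (λ N r A D → N :* r :* A :- N :* D := N :* (r :* A :- D)) ≡.refl N (+ 1 ℚ./ n) A D ⟩
      N ℚ.* (+ 1 ℚ./ n ℚ.* A ℚ.- D)               ∎
      where
      open ≡.≡-Reasoning
      N = ℕ⇒ℚ n
      D = seq d i
      A = seq (sumℝ a) i

    average-deviation : ∀ i → + 1 ℚ./ n ℚ.* deviation i ≡ seq (average a) i ℚ.- seq d i
    average-deviation i = begin
      r ℚ.* deviation i             ≡⟨ cong (r ℚ.*_) (deviation-average i) ⟩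
      r ℚ.* (ℕ⇒ℚ n ℚ.* q)         ≡⟨ ℚ.*-assoc r (ℕ⇒ℚ n) q ⟨
      r ℚ.* ℕ⇒ℚ n ℚ.* q           ≡⟨ cong (ℚ._* q) (≡.trans (ℚ.*-comm r (ℕ⇒ℚ n)) (ℕ⇒ℚ*1/n≡1 n)) ⟩
      1ℚ ℚ.* q                      ≡⟨ ℚ.*-identityˡ q ⟩
      q                             ∎
      where
      open ≡.≡-Reasoning
      r = + 1 ℚ./ n
      q = seq (average a) i ℚ.- seq d i

  average⇒deviation≋0 : average a ≈ d → sum (λ j → seq (a j) +ₛ -ₛ seq d) ≋ 0ₛ
  average⇒deviation≋0 avg = null-≗ _ (λ i → ≡.trans (≡.sym (deviation-average i)) (≡.sym (ℚ.+-identityʳ (deviation i))))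
    (null-ℕ⇒ℚ* n {λ i → seq (average a) i ℚ.- seq d i} avg)

  deviation≋0⇒average : sum (λ j → seq (a j) +ₛ -ₛ seq d) ≋ 0ₛ → average a ≈ d
  deviation≋0⇒average dev = null-≗ _ average-deviation
    (null-1/n* n {deviation} (null-≗ deviation (λ i → ℚ.+-identityʳ (deviation i)) dev))

-- Centring `f` and summing over an orbit.

-- The group argument takes φ on all naturals. For `v` ≥ 1, F(v) only sums over arguments from `v`
-- to `m`, so the default value never enters there.
zeroExtension : ∀ {m} → (⟦ m ⟧ → ℝ) → ℕ → ℝ
zeroExtension {m} f v with (0 <? v) ×-dec (v <? suc m)
... | yes bounds = f (v , [ bounds ])
... | no  _      = 0ℝ

zeroExtension-inside : ∀ {m} (f : ⟦ m ⟧ → ℝ) v → zeroExtension f (value v) ≡ f v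
zeroExtension-inside {m} f (v , [ bounds ]) with (0 <? v) ×-dec (v <? suc m)
... | yes _       = ≡.refl
... | no  ¬bounds = contradiction-irr bounds ¬bounds

module _ {m : ℕ} (f : ⟦ m ⟧ → ℝ) (c : ℝ) where

  centred : ℕ → Sequence
  centred v = seq (zeroExtension f v) +ₛ -ₛ seq c

  -- Applied to the lower bounds, this turns the hypothesis on the averages of `f` into the
  -- vanishing of F at every `l_i`.
  upperSum-centred : ∀ v → upperAverage f v ≈ c → upperSum sequenceGroup m centred (value v) ≋ 0ₛ
  upperSum-centred (v , [ bounds ]) avg = begin
    upperSum sequenceGroup m centred v
      ≡⟨ upperSum-inside sequenceGroup m centred v (recompute (v <? suc m) (proj₂ bounds)) ⟩
    sum {suc (m ∸ v)} (λ j → centred (v + toℕ j))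
      ≡⟨ sum-cong-≗ {suc (m ∸ v)} (λ j → cong (λ r → seq r +ₛ -ₛ seq c) (zeroExtension-inside f (upper j))) ⟩
    sum (λ j → seq (f (upper j)) +ₛ -ₛ seq c)
      ≈⟨ average⇒deviation≋0 (f ∘ upper) c avg ⟩
    0ₛ ∎
    where
    open SetoidReasoning setoid
    upper : Fin (suc (m ∸ v)) → ⟦ m ⟧
    upper j = v + toℕ j , [ ℕ.<-≤-trans (proj₁ bounds) (ℕ.m≤m+n v (toℕ j)) , shift< (proj₂ bounds) j ]

  sum-centred : ∀ {k} (l : S k m) x →
    seq (sumStatistic l f x) +ₛ -ₛ seq (sumℝ {k} λ _ → c) ≋ sum (λ i → centred (coord l x i))
  sum-centred {k} l x = begin
    seq (sumStatistic l f x) +ₛ -ₛ seq (sumℝ {k} λ _ → c)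
      ≡⟨ ≡.cong₂ (λ s t → s +ₛ -ₛ t) (seq-sumℝ (λ i → f (coordinate (value x) i))) (seq-sumℝ {k} (λ _ → c)) ⟩
    sum (λ i → seq (f (coordinate (value x) i))) +ₛ -ₛ sum {k} (λ _ → seq c)
      ≈⟨ sum-difference sequenceGroup (λ i → seq (f (coordinate (value x) i))) (λ _ → seq c) ⟨
    sum (λ i → seq (f (coordinate (value x) i)) +ₛ -ₛ seq c)
      ≡⟨ sum-cong-≗ (λ i → cong (λ r → seq r +ₛ -ₛ seq c) (zeroExtension-inside f (coordinate (value x) i))) ⟨
    sum (λ i → centred (coord l x i)) ∎
    where open SetoidReasoning setoid

mainTheorem7 : (k m : ℕ) → 1 ≤ k → k ≤ m →
    (l : S k m) (ν : Permutation′ k) (f : ⟦ m ⟧ → ℝ) →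
    ((i j : Fin k) → upperAverage f (coordinate l i) ≈ upperAverage f (coordinate l j)) →
    Homomesic (W̲-along l ν) (sumStatistic l f)
-- The constant is `k` times the common average, which is taken at the first index; 1 ≤ k provides
-- that index.
mainTheorem7 k@(suc _) m _ _ l ν f avg = sumℝ {k} (λ _ → c) , λ x →
  let O , iterates , period = cyclicOrbit τ (encode l) (encode-injective l) x
  in O , orbitAverage x O iterates period
  where
  c = upperAverage f (coordinate l zero)

  τ = W̲-along l ν

  l≈0 : ∀ i → upperSum sequenceGroup m (centred f c) (lookup (value l) i) ≋ 0ₛ
  l≈0 i = upperSum-centred f c (coordinate l i) (avg i zero)

  g : S′ l → Sequence
  g x = sum (λ i → centred f c (coord l x i))

  Ψ : S′ l → Sequence
  Ψ = potential sequenceGroup m (centred f c) l ν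

  module _ (x : S′ l) (O : Orbit τ x) (iterates : ∀ j → element O j ≡ fold x (Inverse.to τ) (toℕ j))
           (period : fold x (Inverse.to τ) (size O) ≡ x) where

    open SetoidReasoning setoid

    iter : ℕ → S′ l
    iter = fold x (Inverse.to τ)

    total : Sequence
    total = sum {size O} (λ j → g (iter (toℕ j)))

    total≋0 : total ≋ 0ₛ
    total≋0 = ∙-cancelʳ (Ψ x) total 0ₛ (begin
      -- Since the orbit closes up, Ψ has the same value at both ends of the telescoping sum and
      -- cancels.
      total +ₛ Ψ x                ≡⟨ cong (λ y → total +ₛ Ψ y) period ⟨
      total +ₛ Ψ (iter (size O))  ≈⟨ telescope sequenceGroup (size O) (g ∘ iter) (Ψ ∘ iter)
                                       (λ j → coboundary sequenceGroup m (centred f c) l ν l≈0 (iter j)) ⟩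
      Ψ x                         ≈⟨ identityˡ (Ψ x) ⟨
      0ₛ +ₛ Ψ x                   ∎)

    orbitAverage : average (sumStatistic l f ∘ element O) ≈ sumℝ {k} (λ _ → c)
    orbitAverage = deviation≋0⇒average (sumStatistic l f ∘ element O) (sumℝ {k} (λ _ → c)) (begin
      sum (λ j → seq (sumStatistic l f (element O j)) +ₛ -ₛ seq (sumℝ {k} λ _ → c))
        ≈⟨ sum-cong-≋ (λ j → sum-centred f c l (element O j)) ⟩
      sum (λ j → g (element O j))
        ≡⟨ sum-cong-≗ {size O} (λ j → cong g (iterates j)) ⟩
      total
        ≈⟨ total≋0 ⟩
      0ₛ ∎)
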